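{- Let $n$ be a prime, let $\alpha$ be a primitive element of $\mathbb{F}_{2^n}$, identify $\mathbb{F}_2^n$ with $\mathbb{F}_{2^n}$ as $\mathbb{F}_2$-vector spaces, and let $k\ge 2$. If there exist $\frac{2^n-2}{(2^k-1)(2^k-2)}$ pairwise disjoint complete $k$-dimensional subspaces of $\mathbb{F}_2^n$, then there exists a Steiner structure $\mathbb{S}_2[2,k,n]$.
   Context: For a $k$-dimensional subspace $X=\{0,\alpha^{i_1},\dots,\alpha^{i_{2^k-1}}\}$ of $\mathbb{F}_2^n$ (exponents in $\mathbb{Z}_{2^n-1}$), its difference set is $\Delta(X)=\{i_r-i_s \bmod (2^n-1): 1\le r,s\le 2^k-1,\ r\ne s\}$. $X$ is complete if $|\Delta(X)|=(2^k-1)(2^k-2)$. Two complete subspaces $X,Y$ are disjoint complete if $\Delta(X)\cap\Delta(Y)=\varnothing$. A Steiner structure $\mathbb{S}_2[2,k,n]$ is a set of $k$-dimensional subspaces of $\mathbb{F}_2^n$ such that each $2$-dimensional subspace of $\mathbb{F}_2^n$ is contained in exactly one of them. -}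

module Defs where

open import Algebra.Bundles using (CommutativeRing)
open import Algebra.Module.Bundles.Raw using (RawLeftModule)
open import Algebra.Module.Morphism.Structures using (module LeftModuleMorphisms)
import Algebra.Definitions
import Algebra.Properties.Semiring.Exp
open import Data.Bool.Base using (Bool; true; false; _∧_; _xor_)
open import Data.Fin.Base using (Fin; toℕ)
open import Data.Fin.Subset using (Subset; ∣_∣) renaming (_∈_ to _∈ᶠ_)
open import Data.Nat.Base using (ℕ; suc; _+_; _∸_; _*_; _^_)
open import Data.Nat.DivMod using (_mod_)
open import Data.Product using (∃!)
open import Data.Product.Base using (∃; ∃-syntax; _×_)
open import Data.Vec.Base using (Vec; replicate; zipWith; map; foldr′)
open import Function.Base using (id)
open import Function.Bundles using (_⇔_)
open import Level using (Level; 0ℓ; _⊔_)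
open import Relation.Binary.PropositionalEquality.Core using (_≡_; _≢_)
open import Relation.Nullary.Negation.Core using (¬_)
open import Relation.Unary using (Pred; _∈_; _⊆_; _≐_; _∩_; Empty)

-- 𝔽₂ is Bool with _xor_ as addition and _∧_ as multiplication
-- (cf. Data.Bool.Properties.xor-∧-commutativeRing).

F₂^ : ℕ → Set
F₂^ n = Vec Bool n

module _ {n : ℕ} where

  infixl 6 _⊕_
  infixr 7 _·_

  𝟎 : F₂^ n
  𝟎 = replicate n false

  _⊕_ : F₂^ n → F₂^ n → F₂^ n
  _⊕_ = zipWith _xor_

  _·_ : Bool → F₂^ n → F₂^ n
  c · v = map (c ∧_) v

  linComb : ∀ {k} → Vec Bool k → Vec (F₂^ n) k → F₂^ n
  linComb cs vs = foldr′ _⊕_ 𝟎 (zipWith _·_ cs vs)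

  LinearlyIndependent : ∀ {k} → Vec (F₂^ n) k → Set
  LinearlyIndependent {k} vs = ∀ cs → linComb cs vs ≡ 𝟎 → cs ≡ replicate k false

  Span : ∀ {k} → Vec (F₂^ n) k → Pred (F₂^ n) 0ℓ
  Span vs v = ∃[ cs ] v ≡ linComb cs vs

F₂^-rawLeftModule : ℕ → RawLeftModule Bool 0ℓ 0ℓ
F₂^-rawLeftModule n = record
  { Carrierᴹ = F₂^ n ; _≈ᴹ_ = _≡_ ; _+ᴹ_ = _⊕_ ; _*ₗ_ = _·_ ; 0ᴹ = 𝟎 ; -ᴹ_ = id }

record Subspace (n : ℕ) : Set₁ where
  field
    elements : Pred (F₂^ n) 0ℓ
    𝟎-mem    : 𝟎 ∈ elements
    ⊕-closed : ∀ {u v} → u ∈ elements → v ∈ elements → (u ⊕ v) ∈ elements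
    ·-closed : ∀ c {v} → v ∈ elements → (c · v) ∈ elements

open Subspace public

infix 4 _≈ˢ_ _⊆ˢ_

_≈ˢ_ _⊆ˢ_ : ∀ {n} → Subspace n → Subspace n → Set
V ≈ˢ W = elements V ≐ elements W
V ⊆ˢ W = elements V ⊆ elements W

HasDimension : ∀ {n} → ℕ → Subspace n → Set
HasDimension {n} k V =
  ∃[ basis ] LinearlyIndependent {n} {k} basis × elements V ≐ Span basis

-- 𝕊₂[t,k,n].  Subspaces are compared by _≈ˢ_, so a "set of subspaces" is a
-- predicate that respects it, and "exactly one" means unique up to it.

record IsSteinerStructure (t k n : ℕ) (𝕊 : Pred (Subspace n) 0ℓ) : Set₁ where
  field
    respects    : ∀ {V W} → V ≈ˢ W → V ∈ 𝕊 → W ∈ 𝕊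
    dimension   : ∀ {V} → V ∈ 𝕊 → HasDimension k V
    exactly-one : ∀ W → HasDimension t W → ∃! _≈ˢ_ (λ V → V ∈ 𝕊 × W ⊆ˢ V)

module _ {c ℓ : Level} (F : CommutativeRing c ℓ) where

  open CommutativeRing F using (Carrier; _≈_; 0#; 1#; semiring)
    renaming (_+_ to _+ᶠ_; _*_ to _*ᶠ_; -_ to -ᶠ_)
  open Algebra.Definitions _≈_ using (Invertible)
  open Algebra.Properties.Semiring.Exp semiring using () renaming (_^_ to _^ᶠ_)

  record IsField : Set (c ⊔ ℓ) where
    field
      1≉0        : ¬ (1# ≈ 0#)
      invertible : ∀ x → ¬ (x ≈ 0#) → Invertible 1# _*ᶠ_ x

  record IsPrimitive (α : Carrier) : Set (c ⊔ ℓ) where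
    field
      nonzero   : ¬ (α ≈ 0#)
      generates : ∀ x → ¬ (x ≈ 0#) → ∃[ i ] x ≈ α ^ᶠ i

  scale : Bool → Carrier → Carrier
  scale false x = 0#
  scale true  x = x

  field-rawLeftModule : RawLeftModule Bool c ℓ
  field-rawLeftModule = record
    { Carrierᴹ = Carrier ; _≈ᴹ_ = _≈_ ; _+ᴹ_ = _+ᶠ_ ; _*ₗ_ = scale ; 0ᴹ = 0# ; -ᴹ_ = -ᶠ_ }

  -- An 𝔽₂-linear isomorphism 𝔽₂ⁿ ≅ F.  For a field F its existence says
  -- precisely that F is 𝔽_{2ⁿ}: it forces 2ⁿ elements, and characteristic 2
  -- because v ⊕ v ≡ 𝟎.

  IsIdentification : (n : ℕ) → (F₂^ n → Carrier) → Set (c ⊔ ℓ)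
  IsIdentification n =
    LeftModuleMorphisms.IsLeftModuleIsomorphism (F₂^-rawLeftModule n) field-rawLeftModule

-- ℤ_m is represented by Fin m.

infixl 6 _⊖_

_⊖_ : ∀ {m} → Fin m → Fin m → Fin m
_⊖_ {suc m} i j = (toℕ i + (suc m ∸ toℕ j)) mod suc m

HasCardinality : ∀ {m ℓ} → Pred (Fin m) ℓ → ℕ → Set ℓ
HasCardinality {m} P s = ∃ λ (S : Subset m) → (∀ i → i ∈ᶠ S ⇔ P i) × ∣ S ∣ ≡ s

module _ {c ℓ : Level} (F : CommutativeRing c ℓ) {n : ℕ}
         (φ : F₂^ n → CommutativeRing.Carrier F) (α : CommutativeRing.Carrier F) where

  open CommutativeRing F using (_≈_; semiring)
  open Algebra.Properties.Semiring.Exp semiring using () renaming (_^_ to _^ᶠ_)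

  Exponents : Subspace n → Pred (Fin (2 ^ n ∸ 1)) ℓ
  Exponents X i = ∃[ v ] v ∈ elements X × φ v ≈ α ^ᶠ toℕ i

  Δ : Subspace n → Pred (Fin (2 ^ n ∸ 1)) ℓ
  Δ X d = ∃[ i ] ∃[ j ] i ∈ Exponents X × j ∈ Exponents X × i ≢ j × d ≡ i ⊖ j

  record IsComplete (k : ℕ) (X : Subspace n) : Set ℓ where
    field
      dimension   : HasDimension k X
      cardinality : HasCardinality (Δ X) ((2 ^ k ∸ 1) * (2 ^ k ∸ 2))

  PairwiseDisjointComplete : ∀ {N} → ℕ → (Fin N → Subspace n) → Set ℓ
  PairwiseDisjointComplete k X =
    (∀ a → IsComplete k (X a)) × (∀ a b → a ≢ b → Empty (Δ (X a) ∩ Δ (X b)))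

{-# OPTIONS --safe #-}

-- The blocks of the Steiner structure are the multiples g X_a of the given
-- subspaces by nonzero field elements g.  A 2-dimensional subspace spanned by
-- x and y lies in g X_a iff x = g u and y = g v with u, v in X_a.  Counting
-- shows that (a, u, v) ↦ u / v is a bijection from the triples with u ≠ v
-- nonzero in X_a onto the field elements other than 0 and 1: completeness makes
-- it injective for fixed a, disjointness makes it injective overall, and
-- N (2ᵏ - 1)(2ᵏ - 2) = 2ⁿ - 2 makes it surjective.  So x / y determines a, u and
-- v, and then g = x / u.

module Submission where

open import Defs
open import Algebra.Bundles using (CommutativeRing; RawRing)
open import Algebra.Structures using (IsCommutativeRing)
open import Algebra.Morphism.Structures using (IsRingMonomorphism; module GroupMorphisms)
open import Algebra.Module.Morphism.Structures using (module LeftModuleMorphisms)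
import Algebra.Morphism.RingMonomorphism as RingMonomorphism
import Algebra.Properties.CommutativeSemigroup as CommutativeSemigroupProperties
import Algebra.Properties.Semiring.Exp as Exp
open import Data.Bool.Base using (Bool; true; false; _xor_)
open import Data.Bool.Properties using (xor-∧-commutativeRing; xor-identityˡ; xor-identityʳ; xor-same; ∧-distribʳ-xor) renaming (_≟_ to _≟ᵇ_)
open import Data.Fin.Base using (Fin; zero; suc; toℕ; combine; remQuot; punchIn; punchOut)
open import Data.Fin.Properties using (_≟_; nonZeroIndex; any?; suc-injective; toℕ<n; toℕ-fromℕ<; pigeonhole; injective⇒≤; combine-injective; combine-surjective; remQuot-combine; combine-remQuot; punchIn-injective; punchInᵢ≢i; punchOut-injective; punchIn-punchOut)
open import Data.Fin.Subset using (Subset; ∣_∣; inside; outside) renaming (_∈_ to _∈ᶠ_)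
open import Data.Nat.Base using (ℕ; zero; suc; pred; _+_; _≤_; _∸_; _*_; _^_; _/_; _%_; NonZero; >-nonZero)
open import Data.Nat.DivMod using (m≡m%n+[m/n]*n; m%n<n; _mod_)
open import Data.Nat.Primality using (Prime)
open import Data.Nat.Properties using (+-assoc; +-comm; m∸n+n≡m; ∸-+-assoc; pred[m∸n]≡m∸[1+n]; m<n⇒0<n∸m; m∸n≤m; ≤-trans; ≤-antisym; ≤-refl; ≤-pred; suc-pred; <⇒≤; n<1+n; 1+n≰n)
open import Data.Product.Base using (∃; ∃-syntax; _×_; _,_; proj₁; proj₂; uncurry)
open import Data.Product.Properties using (,-injective)
open import Data.Vec.Base using (Vec; []; _∷_; here; there; map)
open import Data.Vec.Properties using (≡-dec; map-id; map-const; zipWith-identityˡ; zipWith-identityʳ; ∷-injectiveˡ; ∷-injectiveʳ)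
open import Function.Base using (id; _∘_)
open import Function.Bundles using (mk⇔; Equivalence)
open import Function.Definitions using (Injective)
open import Level using (Level; 0ℓ)
open import Relation.Binary.PropositionalEquality.Core using (_≡_; _≢_; refl; sym; trans; cong; cong₂; subst)
open import Relation.Binary.PropositionalEquality.Properties using (module ≡-Reasoning)
open import Relation.Nullary.Decidable.Core using (yes; no)
open import Relation.Nullary.Negation.Core using (¬_; contradiction)
open import Relation.Unary using (Pred; _∈_; _⊆_)

private
  variable
    m s t : ℕ
    A B : Set

-- Counting

-- If `y` were missed, punching it out of the codomain would inject `Fin s` into a set with at most
-- `s ∸ 1` elements.
injective⇒surjective : t ≤ s → (f : Fin s → Fin t) → Injective _≡_ _≡_ f → ∀ y → ∃[ x ] f x ≡ y
injective⇒surjective {suc t} t<s f f-injective y with any? (λ x → f x ≟ y)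
... | yes hit = hit
... | no ¬hit = contradiction (≤-trans t<s (injective⇒≤ avoid-injective)) 1+n≰n
  where
  y≢f : ∀ x → y ≢ f x
  y≢f x eq = ¬hit (x , sym eq)

  avoid-injective : Injective _≡_ _≡_ (λ x → punchOut (y≢f x))
  avoid-injective eq = f-injective (punchOut-injective (y≢f _) (y≢f _) eq)

remQuot-injective : ∀ s t → Injective _≡_ _≡_ (remQuot {s} t)
remQuot-injective s t {i} {j} eq =
  trans (sym (combine-remQuot {s} t i)) (trans (cong (uncurry combine) eq) (combine-remQuot {s} t j))

-- The index may depend on the proof of P x; at-index and injective make that
-- dependence immaterial.
record Enumeration {A : Set} (P : Pred A 0ℓ) (s : ℕ) : Set where
  field
    at        : Fin s → A
    valid     : ∀ i → P (at i)
    injective : Injective _≡_ _≡_ at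
    index     : ∀ {x} → P x → Fin s
    at-index  : ∀ {x} (p : P x) → at (index p) ≡ x

  index-injective : ∀ {x y} {p : P x} {q : P y} → index p ≡ index q → x ≡ y
  index-injective {p = p} {q} eq = trans (sym (at-index p)) (trans (cong at eq) (at-index q))

open Enumeration

-- The predicate λ x → x ≡ x stands for "every x"; unlike λ _ → ⊤ it lets x be
-- inferred from a proof.
Fin-enumeration : Enumeration {Fin s} (λ i → i ≡ i) s
Fin-enumeration = record
  { at = id ; valid = λ _ → refl ; injective = id ; index = λ {i} _ → i ; at-index = λ _ → refl }

subset-enumeration : (S : Subset m) → Enumeration (_∈ᶠ S) ∣ S ∣
subset-enumeration [] = record
  { at = λ () ; valid = λ () ; injective = λ { {()} } ; index = λ () ; at-index = λ () }
subset-enumeration (outside ∷ S) = record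
  { at        = suc ∘ at E
  ; valid     = there ∘ valid E
  ; injective = injective E ∘ suc-injective
  ; index     = λ { (there p) → index E p }
  ; at-index  = λ { (there p) → cong suc (at-index E p) }
  } where E = subset-enumeration S
subset-enumeration {suc m} (inside ∷ S) = record
  { at        = at′
  ; valid     = λ { zero → here ; (suc i) → there (valid E i) }
  ; injective = at′-injective
  ; index     = λ { here → zero ; (there p) → suc (index E p) }
  ; at-index  = λ { here → refl ; (there p) → cong suc (at-index E p) }
  } where
  E = subset-enumeration S

  at′ : Fin (suc ∣ S ∣) → Fin (suc m)
  at′ zero    = zero
  at′ (suc i) = suc (at E i)

  at′-injective : Injective _≡_ _≡_ at′
  at′-injective {zero}  {zero}  eq = refl
  at′-injective {suc i} {suc j} eq = cong suc (injective E (suc-injective eq))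

image-enumeration : {P : Pred A 0ℓ} {Q : Pred B 0ℓ} (f : A → B) → (∀ {x} → P x → Q (f x)) →
  Injective _≡_ _≡_ f → (∀ {y} → Q y → ∃[ x ] P x × f x ≡ y) → Enumeration P s → Enumeration Q s
image-enumeration f P⇒Q f-injective f-onto E = record
  { at        = f ∘ at E
  ; valid     = P⇒Q ∘ valid E
  ; injective = injective E ∘ f-injective
  ; index     = λ q → index E (proj₁ (proj₂ (f-onto q)))
  ; at-index  = λ q → let _ , p , eq = f-onto q in trans (cong f (at-index E p)) eq
  }

-- `punchIn` skips the position of `z`, and `punchOut` closes the resulting gap when an index is
-- computed.
delete : {P : Pred A 0ℓ} {z : A} → P z → Enumeration P s → Enumeration (λ x → P x × x ≢ z) (s ∸ 1)
delete {s = zero}  z∈P E = contradiction (index E z∈P) λ ()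
delete {s = suc s} {P} {z} z∈P E = record
  { at        = at E ∘ punchIn i₀
  ; valid     = λ i → valid E _ , λ eq → punchInᵢ≢i i₀ i (injective E (trans eq (sym (at-index E z∈P))))
  ; injective = punchIn-injective i₀ _ _ ∘ injective E
  ; index     = λ (p , x≢z) → punchOut (i₀≢ p x≢z)
  ; at-index  = λ (p , x≢z) → trans (cong (at E) (punchIn-punchOut (i₀≢ p x≢z))) (at-index E p)
  } where
  i₀ = index E z∈P

  i₀≢ : ∀ {x} (p : P x) → x ≢ z → i₀ ≢ index E p
  i₀≢ p x≢z eq = x≢z (sym (index-injective E eq))

-- Fibres of equal size make `combine` and `remQuot` a numbering of the pairs. Since `G` may depend
-- on the proof of `P x`, a fibre is always enumerated at the canonical proof `valid E i`, and
-- membership is transported there.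
Σ-enumeration : {P : Pred A 0ℓ} {Q : A → Pred B 0ℓ} → Enumeration P s → (∀ {x} → P x → Enumeration (Q x) t) →
  Enumeration (λ (x , y) → P x × Q x y) (s * t)
Σ-enumeration {A} {B} {s} {t} {P} {Q} E G = record
  { at        = pair ∘ remQuot t
  ; valid     = λ i → valid E _ , valid (G (valid E _)) _
  ; injective = remQuot-injective s t ∘ pair-injective
  ; index     = λ (p , q) → combine (index E p) (index (G (valid E _)) (transport p q))
  ; at-index  = λ (p , q) → trans (cong pair (remQuot-combine (index E p) _))
                  (cong₂ _,_ (at-index E p) (at-index (G (valid E _)) (transport p q)))
  } where
  pair : Fin s × Fin t → A × B
  pair (i , j) = at E i , at (G (valid E i)) j

  pair-injective : Injective _≡_ _≡_ pair
  -- Equal first components give equal positions, so both second components come from the same fibre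
  -- enumeration.
  pair-injective {i , j} {i′ , j′} eq with injective E (proj₁ (,-injective eq))
  ... | refl = cong (i ,_) (injective (G (valid E i)) (proj₂ (,-injective eq)))

  transport : ∀ {x y} (p : P x) → Q x y → Q (at E (index E p)) y
  transport {y = y} p = subst (λ x → Q x y) (sym (at-index E p))

-- The nesting and the orientation `y ≢ x` are those produced by `Σ-enumeration` applied to
-- `delete`.
DistinctPairs : Pred A 0ℓ → Pred (A × A) 0ℓ
DistinctPairs P (x , y) = P x × P y × y ≢ x

distinctPairs-enumeration : {P : Pred A 0ℓ} → Enumeration P s → Enumeration (DistinctPairs P) (s * (s ∸ 1))
distinctPairs-enumeration E = Σ-enumeration E (λ p → delete p E)

-- Choosing a preimage for each element of `S` gives an injective map `h` between positions. As both
-- sides have `∣ S ∣` elements, `h` is onto, so every element of `P` is the chosen preimage of its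
-- own value, and the value determines it.
onto⇒injective : {P : Pred A 0ℓ} (f : A → Fin m) (S : Subset m) → Enumeration P ∣ S ∣ →
  (∀ {d} → d ∈ᶠ S → ∃[ x ] P x × f x ≡ d) → ∀ {x y} → P x → P y → f x ≡ f y → x ≡ y
onto⇒injective {m = m} {P} f S E onto p q fx≡fy = index-injective E (trans (sym hi≡) (trans (cong h i≡j) hj≡))
  where
  G = subset-enumeration S

  h : Fin ∣ S ∣ → Fin ∣ S ∣
  h i = index E (proj₁ (proj₂ (onto (valid G i))))

  f-h : ∀ i → f (at E (h i)) ≡ at G i
  f-h i = let _ , p , eq = onto (valid G i) in trans (cong f (at-index E p)) eq

  h-injective : Injective _≡_ _≡_ h
  h-injective eq = injective G (trans (sym (f-h _)) (trans (cong (f ∘ at E) eq) (f-h _)))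

  h-onto : ∀ y → ∃[ i ] h i ≡ y
  h-onto = injective⇒surjective ≤-refl h h-injective

  i = proj₁ (h-onto (index E p))
  j = proj₁ (h-onto (index E q))
  hi≡ = proj₂ (h-onto (index E p))
  hj≡ = proj₂ (h-onto (index E q))

  at-G : ∀ {x i} (p : P x) → h i ≡ index E p → at G i ≡ f x
  at-G p eq = trans (sym (f-h _)) (cong f (trans (cong (at E) eq) (at-index E p)))

  i≡j : i ≡ j
  i≡j = injective G (trans (at-G p hi≡) (trans fx≡fy (sym (at-G q hj≡))))

-- Adjoining `z` as one more value turns `f` into an injection between sets of equal size, which is
-- onto; whatever is not `z` must then come from `P`.
injective⇒onto-others : {P : Pred A 0ℓ} (f : A → Fin m) → m ≡ suc s → Enumeration P s →
  (∀ {x y} → P x → P y → f x ≡ f y → x ≡ y) →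
  (z : Fin m) → (∀ {x} → P x → f x ≢ z) → ∀ d → d ≢ z → ∃[ x ] P x × f x ≡ d
injective⇒onto-others {m = m} {s = s} {P} f refl E f-injective z f≢z d d≢z =
  preimage (injective⇒surjective ≤-refl g g-injective d)
  where
  g : Fin (suc s) → Fin m
  g zero    = z
  g (suc i) = f (at E i)

  g-injective : Injective _≡_ _≡_ g
  g-injective {zero}  {zero}  eq = refl
  g-injective {zero}  {suc j} eq = contradiction (sym eq) (f≢z (valid E j))
  g-injective {suc i} {zero}  eq = contradiction eq (f≢z (valid E i))
  g-injective {suc i} {suc j} eq = cong suc (injective E (f-injective (valid E i) (valid E j) eq))

  preimage : ∃[ i ] g i ≡ d → ∃[ x ] P x × f x ≡ d
  preimage (zero  , z≡d) = contradiction (sym z≡d) d≢z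
  preimage (suc i , eq)  = at E i , valid E i , eq

-- Linear algebra over 𝔽₂

⊕-identityʳ : (u : F₂^ m) → u ⊕ 𝟎 ≡ u
⊕-identityʳ = zipWith-identityʳ xor-identityʳ

⊕-identityˡ : (u : F₂^ m) → 𝟎 ⊕ u ≡ u
⊕-identityˡ = zipWith-identityˡ xor-identityˡ

⊕-self : (u : F₂^ m) → u ⊕ u ≡ 𝟎
⊕-self []      = refl
⊕-self (x ∷ u) = cong₂ _∷_ (xor-same x) (⊕-self u)

⊕≡𝟎⇒≡ : {u v : F₂^ m} → u ⊕ v ≡ 𝟎 → u ≡ v
⊕≡𝟎⇒≡ {u = []}        {[]}        eq = refl
⊕≡𝟎⇒≡ {u = false ∷ u} {false ∷ v} eq = cong (false ∷_) (⊕≡𝟎⇒≡ (∷-injectiveʳ eq))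
⊕≡𝟎⇒≡ {u = true ∷ u}  {true ∷ v}  eq = cong (true ∷_) (⊕≡𝟎⇒≡ (∷-injectiveʳ eq))
⊕≡𝟎⇒≡ {u = false ∷ u} {true ∷ v}  eq = contradiction (∷-injectiveˡ eq) λ ()
⊕≡𝟎⇒≡ {u = true ∷ u}  {false ∷ v} eq = contradiction (∷-injectiveˡ eq) λ ()

⊕-interchange : (u v w x : F₂^ m) → (u ⊕ v) ⊕ (w ⊕ x) ≡ (u ⊕ w) ⊕ (v ⊕ x)
⊕-interchange [] [] [] [] = refl
⊕-interchange (p ∷ u) (q ∷ v) (r ∷ w) (s ∷ x) =
  cong₂ _∷_ (xor-interchange p q r s) (⊕-interchange u v w x)
  where
  open CommutativeSemigroupProperties
    (CommutativeRing.+-commutativeSemigroup xor-∧-commutativeRing)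
    using () renaming (interchange to xor-interchange)

true-· : (v : F₂^ m) → true · v ≡ v
true-· = map-id

false-· : (v : F₂^ m) → false · v ≡ 𝟎
false-· v = map-const v false

·-distribʳ-xor : ∀ c d (v : F₂^ m) → (c xor d) · v ≡ c · v ⊕ d · v
·-distribʳ-xor c d []      = refl
·-distribʳ-xor c d (x ∷ v) = cong₂ _∷_ (∧-distribʳ-xor x c d) (·-distribʳ-xor c d v)

linComb-⊕ : (cs ds : Vec Bool s) (vs : Vec (F₂^ m) s) → linComb (cs ⊕ ds) vs ≡ linComb cs vs ⊕ linComb ds vs
linComb-⊕ []       []       []       = sym (⊕-self 𝟎)
linComb-⊕ (c ∷ cs) (d ∷ ds) (v ∷ vs) = trans
  (cong₂ _⊕_ (·-distribʳ-xor c d v) (linComb-⊕ cs ds vs))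
  (⊕-interchange (c · v) (d · v) (linComb cs vs) (linComb ds vs))

linComb-𝟎 : (vs : Vec (F₂^ m) s) → linComb 𝟎 vs ≡ 𝟎
linComb-𝟎 []       = refl
linComb-𝟎 (v ∷ vs) = trans (cong₂ _⊕_ (false-· v) (linComb-𝟎 vs)) (⊕-self 𝟎)

-- Over 𝔽₂ subtraction is `⊕`, so two equal combinations give a relation with coefficients
-- `cs ⊕ ds`.
linComb-injective : {vs : Vec (F₂^ m) s} → LinearlyIndependent vs → Injective _≡_ _≡_ (λ cs → linComb cs vs)
linComb-injective {vs = vs} independent {cs} {ds} eq = ⊕≡𝟎⇒≡ (independent (cs ⊕ ds)
  (trans (linComb-⊕ cs ds vs) (trans (cong (_⊕ linComb ds vs) eq) (⊕-self _))))

-- Over 𝔽₂ additivity already gives linearity, the only scalars being 0 and 1. The instance of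
-- interest is multiplication by a fixed field element.
record IsAdditive (f : F₂^ m → F₂^ m) : Set where
  field
    𝟎-homo : f 𝟎 ≡ 𝟎
    ⊕-homo : ∀ u v → f (u ⊕ v) ≡ f u ⊕ f v

  ·-homo : ∀ c v → f (c · v) ≡ c · f v
  ·-homo true  v = trans (cong f (true-· v)) (sym (true-· (f v)))
  ·-homo false v = trans (cong f (false-· v)) (trans 𝟎-homo (sym (false-· (f v))))

  linComb-map : (cs : Vec Bool s) (vs : Vec (F₂^ m) s) → linComb cs (map f vs) ≡ f (linComb cs vs)
  linComb-map []       []       = sym 𝟎-homo
  linComb-map (c ∷ cs) (v ∷ vs) = trans
    (cong₂ _⊕_ (sym (·-homo c v)) (linComb-map cs vs))
    (sym (⊕-homo (c · v) (linComb cs vs)))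

  image : Subspace m → Subspace m
  image X = record
    { elements = λ v → ∃[ u ] u ∈ elements X × v ≡ f u
    ; 𝟎-mem    = 𝟎 , 𝟎-mem X , sym 𝟎-homo
    ; ⊕-closed = λ { (u , u∈ , refl) (v , v∈ , refl) → u ⊕ v , ⊕-closed X u∈ v∈ , sym (⊕-homo u v) }
    ; ·-closed = λ { c (u , u∈ , refl) → c · u , ·-closed X c u∈ , sym (·-homo c u) }
    }

  -- The images of a basis form a basis: a relation among them is `f` of a combination of `vs`,
  -- which a trivial kernel forces to vanish.
  image-dimension : ∀ {k X} → (∀ {u} → f u ≡ 𝟎 → u ≡ 𝟎) → HasDimension k X → HasDimension k (image X)
  image-dimension f-kernel (vs , independent , X⊆ , ⊆X) =
    map f vs ,
    (λ cs eq → independent cs (f-kernel (trans (sym (linComb-map cs vs)) eq))) ,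
    (λ { (u , u∈ , refl) → let cs , u≡ = X⊆ u∈ in cs , trans (cong f u≡) (sym (linComb-map cs vs)) }) ,
    (λ { (cs , refl) → linComb cs vs , ⊆X (cs , refl) , linComb-map cs vs })

HasDimension-resp-≈ˢ : ∀ {k} {V W : Subspace m} → V ≈ˢ W → HasDimension k W → HasDimension k V
HasDimension-resp-≈ˢ (V⊆W , W⊆V) (vs , independent , W⊆ , ⊆W) = vs , independent , W⊆ ∘ V⊆W , W⊆V ∘ ⊆W

module _ {x y : F₂^ m} where

  linComb₁₀ : linComb (true ∷ false ∷ []) (x ∷ y ∷ []) ≡ x
  linComb₁₀ = trans (cong₂ _⊕_ (true-· x) (trans (⊕-identityʳ _) (false-· y))) (⊕-identityʳ x)

  linComb₀₁ : linComb (false ∷ true ∷ []) (x ∷ y ∷ []) ≡ y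
  linComb₀₁ = trans (cong₂ _⊕_ (false-· x) (trans (⊕-identityʳ _) (true-· y))) (⊕-identityˡ y)

  linComb₁₁ : linComb (true ∷ true ∷ []) (x ∷ y ∷ []) ≡ x ⊕ y
  linComb₁₁ = cong₂ _⊕_ (true-· x) (trans (⊕-identityʳ _) (true-· y))

  module _ (independent : LinearlyIndependent (x ∷ y ∷ [])) where

    -- Otherwise the coefficients (1,0) would give a vanishing combination; (0,1) and (1,1) serve
    -- the next two facts.
    independent⇒≢𝟎ˡ : x ≢ 𝟎
    independent⇒≢𝟎ˡ eq with () ← independent (true ∷ false ∷ []) (trans linComb₁₀ eq)

    independent⇒≢𝟎ʳ : y ≢ 𝟎
    independent⇒≢𝟎ʳ eq with () ← independent (false ∷ true ∷ []) (trans linComb₀₁ eq)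

    independent⇒≢ : y ≢ x
    independent⇒≢ eq with () ← independent (true ∷ true ∷ []) (trans linComb₁₁ (trans (cong (x ⊕_) eq) (⊕-self x)))

span₂⊆ : ∀ {x y} (V : Subspace m) → x ∈ elements V → y ∈ elements V → Span (x ∷ y ∷ []) ⊆ elements V
span₂⊆ V x∈ y∈ (c ∷ d ∷ [] , refl) = ⊕-closed V (·-closed V c x∈) (⊕-closed V (·-closed V d y∈) (𝟎-mem V))

-- Counting vectors and the nonzero elements of subspaces

encode : Vec Bool m → Fin (2 ^ m)
encode []          = zero
-- `2 ^ suc m` unfolds to `2 * 2 ^ m`, so `combine {2}` makes the head the leading binary digit.
encode (false ∷ v) = combine {2} zero (encode v)
encode (true ∷ v)  = combine {2} (suc zero) (encode v)

encode-injective : Injective _≡_ _≡_ (encode {m})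
encode-injective {x = []}        {[]}        eq = refl
encode-injective {x = false ∷ u} {false ∷ v} eq =
  cong (false ∷_) (encode-injective (proj₂ (combine-injective {2} zero (encode u) zero (encode v) eq)))
encode-injective {x = true ∷ u}  {true ∷ v}  eq =
  cong (true ∷_) (encode-injective (proj₂ (combine-injective {2} (suc zero) (encode u) (suc zero) (encode v) eq)))
encode-injective {x = false ∷ u} {true ∷ v}  eq =
  contradiction (proj₁ (combine-injective {2} zero (encode u) (suc zero) (encode v) eq)) λ ()
encode-injective {x = true ∷ u}  {false ∷ v} eq =
  contradiction (proj₁ (combine-injective {2} (suc zero) (encode u) zero (encode v) eq)) λ ()

encode-surjective : (i : Fin (2 ^ m)) → ∃[ v ] encode {m} v ≡ i
encode-surjective {zero}  zero = [] , refl
encode-surjective {suc m} i with combine-surjective {2} {2 ^ m} i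
... | zero     , j , refl with v , refl ← encode-surjective {m} j = false ∷ v , refl
... | suc zero , j , refl with v , refl ← encode-surjective {m} j = true ∷ v , refl

vector-enumeration : ∀ m → Enumeration {F₂^ m} (λ v → v ≡ v) (2 ^ m)
vector-enumeration m = record
  { at        = λ i → proj₁ (encode-surjective {m} i)
  ; valid     = λ _ → refl
  ; injective = λ {i} {j} eq →
      trans (sym (proj₂ (encode-surjective {m} i))) (trans (cong (encode {m}) eq) (proj₂ (encode-surjective {m} j)))
  ; index     = λ {v} _ → encode v
  ; at-index  = λ {v} _ → encode-injective (proj₂ (encode-surjective {m} (encode v)))
  }

Nonzero : Subspace m → Pred (F₂^ m) 0ℓ
Nonzero X v = v ∈ elements X × v ≢ 𝟎

nonzero-enumeration : ∀ m → Enumeration {F₂^ m} (λ v → v ≡ v × v ≢ 𝟎) (2 ^ m ∸ 1)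
nonzero-enumeration m = delete refl (vector-enumeration m)

-- Coordinates with respect to a basis match the nonzero vectors of `X` with the nonzero vectors of
-- length `k`.
subspace-enumeration : ∀ {k} {X : Subspace m} → HasDimension k X → Enumeration (Nonzero X) (2 ^ k ∸ 1)
subspace-enumeration {k = k} (vs , independent , X⊆ , ⊆X) = image-enumeration (λ cs → linComb cs vs)
  (λ {cs} (_ , cs≢𝟎) → ⊆X (cs , refl) , cs≢𝟎 ∘ independent cs)
  (linComb-injective independent)
  (λ (v∈ , v≢𝟎) → let cs , v≡ = X⊆ v∈ in
     cs , (refl , λ cs≡𝟎 → v≢𝟎 (trans v≡ (trans (cong (λ cs → linComb cs vs) cs≡𝟎) (linComb-𝟎 vs)))) , sym v≡)
  (nonzero-enumeration k)

-- This is the number of differences counted with repetition, so completeness says that no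
-- difference repeats.
distinctPairs-subspace-enumeration : ∀ {k} {X : Subspace m} → HasDimension k X →
  Enumeration (DistinctPairs (Nonzero X)) ((2 ^ k ∸ 1) * (2 ^ k ∸ 2))
-- The two deletions, of `𝟎` and of the first entry, leave `2 ^ k ∸ 1 ∸ 1`.
distinctPairs-subspace-enumeration {k = k} {X} dim = subst
  (λ t → Enumeration (DistinctPairs (Nonzero X)) ((2 ^ k ∸ 1) * t)) (∸-+-assoc (2 ^ k) 1 1)
  (distinctPairs-enumeration (subspace-enumeration {X = X} dim))

-- Field structures on 𝔽₂ⁿ

-- Subtraction modulo `m` is restated with sums only, ready to be read in exponents. The `m` on the
-- right is the one that `⊖` adds to keep the natural subtraction exact.
⊖-spec : (i j : Fin m) → ∃[ q ] toℕ (i ⊖ j) + toℕ j + q * m ≡ toℕ i + m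
⊖-spec {suc m} i j = q , (begin
  toℕ (i ⊖ j) + toℕ j + q * M    ≡⟨ cong (λ r → r + toℕ j + q * M) (toℕ-fromℕ< (m%n<n x M)) ⟩
  x % M + toℕ j + q * M          ≡⟨ +-assoc (x % M) (toℕ j) (q * M) ⟩
  x % M + (toℕ j + q * M)        ≡⟨ cong (x % M +_) (+-comm (toℕ j) (q * M)) ⟩
  x % M + (q * M + toℕ j)        ≡⟨ +-assoc (x % M) (q * M) (toℕ j) ⟨
  x % M + q * M + toℕ j          ≡⟨ cong (_+ toℕ j) (m≡m%n+[m/n]*n x M) ⟨
  x + toℕ j                      ≡⟨ +-assoc (toℕ i) (M ∸ toℕ j) (toℕ j) ⟩
  toℕ i + (M ∸ toℕ j + toℕ j)    ≡⟨ cong (toℕ i +_) (m∸n+n≡m (<⇒≤ (toℕ<n j))) ⟩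
  toℕ i + M                      ∎)
  where
  open ≡-Reasoning
  M = suc m
  x = toℕ i + (M ∸ toℕ j)
  q = x / M

-- Addition is fixed to `⊕`, so negation is `id`; equality is propositional, so the counting lemmas
-- apply directly.
ringOn : {mul : F₂^ m → F₂^ m → F₂^ m} {one : F₂^ m} →
  IsCommutativeRing _≡_ _⊕_ mul id 𝟎 one → CommutativeRing 0ℓ 0ℓ
ringOn isCommutativeRing = record { isCommutativeRing = isCommutativeRing }

module FieldOnVectors {n : ℕ} {mul : F₂^ n → F₂^ n → F₂^ n} {one : F₂^ n}
  (isCommutativeRing : IsCommutativeRing _≡_ _⊕_ mul id 𝟎 one)
  (isField : IsField (ringOn isCommutativeRing))
  (α : F₂^ n) (isPrimitive : IsPrimitive (ringOn isCommutativeRing) α)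
  where

  private
    R = ringOn isCommutativeRing

  open CommutativeRing R
    using (*-assoc; *-comm; *-identityˡ; *-identityʳ; distribˡ; zeroˡ; zeroʳ; *-commutativeSemigroup; semiring)
    renaming (_*_ to infixl 7 _⊛_; 1# to 𝟏)
  open IsField isField using (invertible) renaming (1≉0 to 𝟏≢𝟎)
  open IsPrimitive isPrimitive using (generates) renaming (nonzero to α≢𝟎)
  open CommutativeSemigroupProperties *-commutativeSemigroup using (xy∙z≈xz∙y)
  open Exp semiring using (^-homo-*) renaming (_^_ to _^ᶠ_)
  open ≡-Reasoning

  order : ℕ
  order = 2 ^ n ∸ 1

  cancelʳ : ∀ {u v w} → w ≢ 𝟎 → u ⊛ w ≡ v ⊛ w → u ≡ v
  cancelʳ {u} {v} {w} w≢𝟎 eq with w⁻¹ , _ , w⊛w⁻¹≡𝟏 ← invertible w w≢𝟎 = begin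
    u              ≡⟨ expand u ⟩
    (u ⊛ w) ⊛ w⁻¹  ≡⟨ cong (_⊛ w⁻¹) eq ⟩
    (v ⊛ w) ⊛ w⁻¹  ≡⟨ expand v ⟨
    v              ∎
    where
    expand : ∀ x → x ≡ (x ⊛ w) ⊛ w⁻¹
    expand x = sym (trans (*-assoc x w w⁻¹) (trans (cong (x ⊛_) w⊛w⁻¹≡𝟏) (*-identityʳ x)))

  cancelˡ : ∀ {u v w} → w ≢ 𝟎 → w ⊛ u ≡ w ⊛ v → u ≡ v
  cancelˡ {u} {v} {w} w≢𝟎 eq = cancelʳ w≢𝟎 (trans (*-comm u w) (trans eq (*-comm w v)))

  ⊛≡𝟎⇒≡𝟎 : ∀ {u v} → u ≢ 𝟎 → u ⊛ v ≡ 𝟎 → v ≡ 𝟎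
  ⊛≡𝟎⇒≡𝟎 {u} u≢𝟎 eq = cancelˡ u≢𝟎 (trans eq (sym (zeroʳ u)))

  α^≢𝟎 : ∀ i → α ^ᶠ i ≢ 𝟎
  α^≢𝟎 zero    = 𝟏≢𝟎
  α^≢𝟎 (suc i) = α^≢𝟎 i ∘ ⊛≡𝟎⇒≡𝟎 α≢𝟎

  α^*≡𝟏 : ∀ e → α ^ᶠ e ≡ 𝟏 → ∀ q → α ^ᶠ (q * e) ≡ 𝟏
  α^*≡𝟏 e α^e≡𝟏 zero    = refl
  α^*≡𝟏 e α^e≡𝟏 (suc q) =
    trans (^-homo-* α e (q * e)) (trans (cong₂ _⊛_ α^e≡𝟏 (α^*≡𝟏 e α^e≡𝟏 q)) (*-identityʳ 𝟏))

  α^+*≡ : ∀ e → α ^ᶠ e ≡ 𝟏 → ∀ i q → α ^ᶠ (i + q * e) ≡ α ^ᶠ i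
  α^+*≡ e α^e≡𝟏 i q =
    trans (^-homo-* α i (q * e)) (trans (cong (α ^ᶠ i ⊛_) (α^*≡𝟏 e α^e≡𝟏 q)) (*-identityʳ (α ^ᶠ i)))

  α^mod : ∀ e .{{_ : NonZero e}} → α ^ᶠ e ≡ 𝟏 → ∀ i → α ^ᶠ toℕ (i mod e) ≡ α ^ᶠ i
  α^mod e α^e≡𝟏 i = begin
    α ^ᶠ toℕ (i mod e)          ≡⟨ cong (α ^ᶠ_) (toℕ-fromℕ< (m%n<n i e)) ⟩
    α ^ᶠ (i % e)                ≡⟨ α^+*≡ e α^e≡𝟏 (i % e) (i / e) ⟨
    α ^ᶠ (i % e + (i / e) * e)  ≡⟨ cong (α ^ᶠ_) (m≡m%n+[m/n]*n i e) ⟨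
    α ^ᶠ i                      ∎

  private
    nonzeros : Enumeration (λ v → v ≡ v × v ≢ 𝟎) order
    nonzeros = nonzero-enumeration n

  instance
    -- The nonzero element `𝟏` has an index, so `Fin order` is inhabited.
    order-nonZero : NonZero order
    order-nonZero = nonZeroIndex (index nonzeros (refl , 𝟏≢𝟎))

  -- Two of the first 2ⁿ powers of α agree, so α has a period e ≤ 2ⁿ - 1; but
  -- all 2ⁿ - 1 nonzero elements occur among its first e powers.
  α^order≡𝟏 : α ^ᶠ order ≡ 𝟏
  α^order≡𝟏
    with i , j , i<j , eq ← pigeonhole (n<1+n order) (λ i → index nonzeros (refl , α^≢𝟎 (toℕ i)))
    = subst (λ e → α ^ᶠ e ≡ 𝟏) (≤-antisym e≤order (injective⇒≤ residue-injective)) α^e≡𝟏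
    where
    e = toℕ j ∸ toℕ i

    e≤order : e ≤ order
    e≤order = ≤-trans (m∸n≤m (toℕ j) (toℕ i)) (≤-pred (toℕ<n j))

    α^e≡𝟏 : α ^ᶠ e ≡ 𝟏
    α^e≡𝟏 = cancelʳ (α^≢𝟎 (toℕ i)) (begin
      α ^ᶠ e ⊛ α ^ᶠ toℕ i   ≡⟨ ^-homo-* α e (toℕ i) ⟨
      α ^ᶠ (e + toℕ i)      ≡⟨ cong (α ^ᶠ_) (m∸n+n≡m (<⇒≤ i<j)) ⟩
      α ^ᶠ toℕ j            ≡⟨ index-injective nonzeros eq ⟨
      α ^ᶠ toℕ i            ≡⟨ *-identityˡ (α ^ᶠ toℕ i) ⟨
      𝟏 ⊛ α ^ᶠ toℕ i        ∎)

    instance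
      e-nonZero : NonZero e
      e-nonZero = >-nonZero (m<n⇒0<n∸m i<j)

    residue : Fin order → Fin e
    residue r = proj₁ (generates (at nonzeros r) (proj₂ (valid nonzeros r))) mod e

    α^residue : ∀ r → α ^ᶠ toℕ (residue r) ≡ at nonzeros r
    α^residue r = let i , v≡α^i = generates _ (proj₂ (valid nonzeros r)) in
      trans (α^mod e α^e≡𝟏 i) (sym v≡α^i)

    residue-injective : Injective _≡_ _≡_ residue
    residue-injective eq = injective nonzeros
      (trans (sym (α^residue _)) (trans (cong (λ r → α ^ᶠ toℕ r) eq) (α^residue _)))

  -- The value at 𝟎 is junk.
  log : F₂^ n → Fin order
  log v with ≡-dec _≟ᵇ_ v 𝟎
  ... | yes _  = 0 mod order
  ... | no v≢𝟎 = proj₁ (generates v v≢𝟎) mod order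

  α^log : ∀ {v} → v ≢ 𝟎 → α ^ᶠ toℕ (log v) ≡ v
  α^log {v} v≢𝟎 with ≡-dec _≟ᵇ_ v 𝟎
  ... | yes v≡𝟎  = contradiction v≡𝟎 v≢𝟎
  ... | no  v≢𝟎′ = let i , v≡α^i = generates v v≢𝟎′ in trans (α^mod order α^order≡𝟏 i) (sym v≡α^i)

  log-injective : ∀ {u v} → u ≢ 𝟎 → v ≢ 𝟎 → log u ≡ log v → u ≡ v
  log-injective u≢𝟎 v≢𝟎 eq = trans (sym (α^log u≢𝟎)) (trans (cong (λ i → α ^ᶠ toℕ i) eq) (α^log v≢𝟎))

  -- `log` is injective on the `order` many nonzero elements, hence every `i` is the `log` of some
  -- `v`, and then `α ^ᶠ toℕ i` is `v` itself.
  log-α^ : ∀ i → log (α ^ᶠ toℕ i) ≡ i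
  log-α^ i
    with r , refl ← injective⇒surjective ≤-refl (log ∘ at nonzeros)
           (injective nonzeros ∘ log-injective (proj₂ (valid nonzeros _)) (proj₂ (valid nonzeros _))) i
    = cong log (α^log (proj₂ (valid nonzeros r)))

  -- Subtracting exponents divides powers; the multiples of `order` in `⊖-spec` disappear because
  -- `α ^ᶠ order` is `𝟏`.
  α^⊖ : ∀ (i j : Fin order) → α ^ᶠ toℕ (i ⊖ j) ⊛ α ^ᶠ toℕ j ≡ α ^ᶠ toℕ i
  α^⊖ i j with q , eq ← ⊖-spec i j = begin
    α ^ᶠ toℕ (i ⊖ j) ⊛ α ^ᶠ toℕ j           ≡⟨ ^-homo-* α (toℕ (i ⊖ j)) (toℕ j) ⟨
    α ^ᶠ (toℕ (i ⊖ j) + toℕ j)              ≡⟨ α^+*≡ order α^order≡𝟏 (toℕ (i ⊖ j) + toℕ j) q ⟨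
    α ^ᶠ (toℕ (i ⊖ j) + toℕ j + q * order)  ≡⟨ cong (α ^ᶠ_) eq ⟩
    α ^ᶠ (toℕ i + order)                    ≡⟨ ^-homo-* α (toℕ i) order ⟩
    α ^ᶠ toℕ i ⊛ α ^ᶠ order                 ≡⟨ cong (α ^ᶠ toℕ i ⊛_) α^order≡𝟏 ⟩
    α ^ᶠ toℕ i ⊛ 𝟏                          ≡⟨ *-identityʳ (α ^ᶠ toℕ i) ⟩
    α ^ᶠ toℕ i                              ∎

  -- Differences of exponents as logarithms of quotients

  logRatio : F₂^ n → F₂^ n → Fin order
  logRatio u v = log u ⊖ log v

  α^logRatio : ∀ {u v} → u ≢ 𝟎 → v ≢ 𝟎 → α ^ᶠ toℕ (logRatio u v) ⊛ v ≡ u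
  α^logRatio {u} {v} u≢𝟎 v≢𝟎 = begin
    α ^ᶠ toℕ (logRatio u v) ⊛ v                    ≡⟨ cong (α ^ᶠ toℕ (logRatio u v) ⊛_) (α^log v≢𝟎) ⟨
    α ^ᶠ toℕ (logRatio u v) ⊛ α ^ᶠ toℕ (log v)     ≡⟨ α^⊖ (log u) (log v) ⟩
    α ^ᶠ toℕ (log u)                               ≡⟨ α^log u≢𝟎 ⟩
    u                                              ∎

  cross-multiply : ∀ {r u v} → r ⊛ v ≡ u → ∀ w → r ⊛ w ⊛ v ≡ u ⊛ w
  cross-multiply {r} {v = v} eq w = trans (xy∙z≈xz∙y r w v) (cong (_⊛ w) eq)

  -- If `r` is the common quotient, `r ⊛ v′ ⊛ v` equals both sides.
  logRatio≡⇒ : ∀ {u v u′ v′} → u ≢ 𝟎 → v ≢ 𝟎 → u′ ≢ 𝟎 → v′ ≢ 𝟎 →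
    logRatio u v ≡ logRatio u′ v′ → u ⊛ v′ ≡ u′ ⊛ v
  logRatio≡⇒ {u} {v} {u′} {v′} u≢𝟎 v≢𝟎 u′≢𝟎 v′≢𝟎 eq = begin
    u ⊛ v′                              ≡⟨ cross-multiply (α^logRatio u≢𝟎 v≢𝟎) v′ ⟨
    α ^ᶠ toℕ (logRatio u v) ⊛ v′ ⊛ v    ≡⟨ cong (λ d → α ^ᶠ toℕ d ⊛ v′ ⊛ v) eq ⟩
    α ^ᶠ toℕ (logRatio u′ v′) ⊛ v′ ⊛ v  ≡⟨ cong (_⊛ v) (α^logRatio u′≢𝟎 v′≢𝟎) ⟩
    u′ ⊛ v                              ∎

  -- Both quotients agree after multiplication by `v′ ⊛ v`, which cancels; `log-α^` then recovers
  -- the exponents.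
  ⇒logRatio≡ : ∀ {u v u′ v′} → u ≢ 𝟎 → v ≢ 𝟎 → u′ ≢ 𝟎 → v′ ≢ 𝟎 →
    u ⊛ v′ ≡ u′ ⊛ v → logRatio u v ≡ logRatio u′ v′
  ⇒logRatio≡ {u} {v} {u′} {v′} u≢𝟎 v≢𝟎 u′≢𝟎 v′≢𝟎 eq =
    trans (sym (log-α^ _)) (trans (cong log α^≡) (log-α^ _))
    where
    α^≡ : α ^ᶠ toℕ (logRatio u v) ≡ α ^ᶠ toℕ (logRatio u′ v′)
    α^≡ = cancelʳ v′≢𝟎 (cancelʳ v≢𝟎 (begin
      α ^ᶠ toℕ (logRatio u v) ⊛ v′ ⊛ v    ≡⟨ cross-multiply (α^logRatio u≢𝟎 v≢𝟎) v′ ⟩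
      u ⊛ v′                              ≡⟨ eq ⟩
      u′ ⊛ v                              ≡⟨ cong (_⊛ v) (α^logRatio u′≢𝟎 v′≢𝟎) ⟨
      α ^ᶠ toℕ (logRatio u′ v′) ⊛ v′ ⊛ v  ∎))

  -- The pair is the two powers of `α` with exponents `i` and `j`. They are nonzero, and distinct
  -- because `log` recovers the exponents.
  Δ⇒logRatio : ∀ X {d} → d ∈ Δ R id α X →
    ∃[ p ] DistinctPairs (Nonzero X) p × uncurry logRatio p ≡ d
  Δ⇒logRatio X (i , j , (_ , u∈X , refl) , (_ , v∈X , refl) , i≢j , refl) =
    _ , ((u∈X , α^≢𝟎 (toℕ i)) , (v∈X , α^≢𝟎 (toℕ j)) , v≢u) , cong₂ _⊖_ (log-α^ i) (log-α^ j)
    where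
    v≢u : α ^ᶠ toℕ j ≢ α ^ᶠ toℕ i
    v≢u eq = i≢j (trans (sym (log-α^ i)) (trans (cong log (sym eq)) (log-α^ j)))

  logRatio∈Δ : ∀ X {u v} → DistinctPairs (Nonzero X) (u , v) → logRatio u v ∈ Δ R id α X
  logRatio∈Δ X {u} {v} ((u∈X , u≢𝟎) , (v∈X , v≢𝟎) , v≢u) =
    log u , log v , (u , u∈X , sym (α^log u≢𝟎)) , (v , v∈X , sym (α^log v≢𝟎)) ,
    v≢u ∘ log-injective v≢𝟎 u≢𝟎 ∘ sym , refl

  -- The differences cover `Δ X`, which by completeness has as many elements as there are pairs, so
  -- no two pairs share a difference.
  complete⇒logRatio-injective : ∀ {k X} → IsComplete R id α k X →
    ∀ {p q} → DistinctPairs (Nonzero X) p → DistinctPairs (Nonzero X) q →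
    uncurry logRatio p ≡ uncurry logRatio q → p ≡ q
  complete⇒logRatio-injective {k} {X} complete
    with S , S⇔Δ , ∣S∣≡ ← IsComplete.cardinality complete =
    onto⇒injective (uncurry logRatio) S
      (subst (Enumeration _) (sym ∣S∣≡)
        (distinctPairs-subspace-enumeration {X = X} (IsComplete.dimension complete)))
      (Δ⇒logRatio X ∘ Equivalence.to (S⇔Δ _))

  -- The Steiner structure of multiples

  module _ {k N : ℕ} (count : N * ((2 ^ k ∸ 1) * (2 ^ k ∸ 2)) ≡ 2 ^ n ∸ 2)
    (X : Fin N → Subspace n) (disjointComplete : PairwiseDisjointComplete R id α k X)
    where

    private
      complete : ∀ a → IsComplete R id α k (X a)
      complete = proj₁ disjointComplete

    Triple : Pred (Fin N × F₂^ n × F₂^ n) 0ℓ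
    Triple (a , p) = a ≡ a × DistinctPairs (Nonzero (X a)) p

    ratio : Fin N × F₂^ n × F₂^ n → Fin order
    ratio (_ , u , v) = logRatio u v

    ratio-injective : ∀ {p q} → Triple p → Triple q → ratio p ≡ ratio q → p ≡ q
    ratio-injective {a , _} {b , _} (_ , p∈) (_ , q∈) eq with a ≟ b
    ... | yes refl = cong (a ,_) (complete⇒logRatio-injective (complete a) p∈ q∈ eq)
    ... | no  a≢b  = contradiction
      (logRatio∈Δ (X a) p∈ , subst (_∈ Δ R id α (X b)) (sym eq) (logRatio∈Δ (X b) q∈))
      (proj₂ disjointComplete a b a≢b _)

    triples : Enumeration Triple (N * ((2 ^ k ∸ 1) * (2 ^ k ∸ 2)))
    triples = Σ-enumeration Fin-enumeration
      (λ {a} _ → distinctPairs-subspace-enumeration {X = X a} (IsComplete.dimension (complete a)))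

    -- The extra 1 accounts for the quotient 1, which no triple attains.
    order≡ : order ≡ suc (N * ((2 ^ k ∸ 1) * (2 ^ k ∸ 2)))
    order≡ = begin
      order              ≡⟨ suc-pred order ⟨
      suc (pred order)   ≡⟨ cong suc (pred[m∸n]≡m∸[1+n] (2 ^ n) 1) ⟩
      suc (2 ^ n ∸ 2)    ≡⟨ cong suc count ⟨
      suc (N * ((2 ^ k ∸ 1) * (2 ^ k ∸ 2)))  ∎

    ratio-onto : ∀ {x y} → x ≢ 𝟎 → y ≢ 𝟎 → y ≢ x → ∃[ p ] Triple p × ratio p ≡ logRatio x y
    ratio-onto {x} {y} x≢𝟎 y≢𝟎 y≢x =
      -- The excluded value is the exponent of the quotient 1, attained only by equal entries.
      injective⇒onto-others ratio order≡ triples ratio-injective (logRatio 𝟏 𝟏)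
        (λ (_ , (_ , u≢𝟎) , (_ , v≢𝟎) , v≢u) → logRatio≢ u≢𝟎 v≢𝟎 v≢u)
        (logRatio x y) (logRatio≢ x≢𝟎 y≢𝟎 y≢x)
      where
      logRatio≢ : ∀ {u v} → u ≢ 𝟎 → v ≢ 𝟎 → v ≢ u → logRatio u v ≢ logRatio 𝟏 𝟏
      logRatio≢ {u} {v} u≢𝟎 v≢𝟎 v≢u eq = v≢u (sym (begin
        u      ≡⟨ *-identityʳ u ⟨
        u ⊛ 𝟏  ≡⟨ logRatio≡⇒ u≢𝟎 v≢𝟎 𝟏≢𝟎 𝟏≢𝟎 eq ⟩
        𝟏 ⊛ v  ≡⟨ *-identityˡ v ⟩
        v      ∎))

    scaling : ∀ g → IsAdditive (g ⊛_)
    scaling g = record { 𝟎-homo = zeroʳ g ; ⊕-homo = distribˡ g }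

    multiple : F₂^ n → Fin N → Subspace n
    multiple g a = IsAdditive.image (scaling g) (X a)

    -- Taking multiples up to `≈ˢ` makes the family respect equality of subspaces.
    blocks : Pred (Subspace n) 0ℓ
    blocks V = ∃[ a ] ∃[ g ] g ≢ 𝟎 × V ≈ˢ multiple g a

    blocks-isSteinerStructure : IsSteinerStructure 2 k n blocks
    blocks-isSteinerStructure = record
      { respects    = λ { (V⊆W , W⊆V) (a , g , g≢𝟎 , V⊆gX , gX⊆V) →
          a , g , g≢𝟎 , V⊆gX ∘ W⊆V , V⊆W ∘ gX⊆V }
      ; dimension   = λ { {V} (a , g , g≢𝟎 , V≈gX) →
          HasDimension-resp-≈ˢ {V = V} {multiple g a} V≈gX
            (IsAdditive.image-dimension (scaling g) {X = X a} (⊛≡𝟎⇒≡𝟎 g≢𝟎)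
              (IsComplete.dimension (complete a))) }
      ; exactly-one = λ { W (x ∷ y ∷ [] , independent , W⊆ , ⊆W) →
          let open Through independent in
          multiple g a ,
          ( (a , g , g≢𝟎 , id , id)
          , span₂⊆ (multiple g a) (u , u∈X , sym g⊛u≡x) (v , v∈X , sym g⊛v≡y) ∘ W⊆ ) ,
          λ { {V} ((b , h , _ , V⊆hX , hX⊆V) , W⊆V) →
            -- `x` and `y` are the combinations (1,0) and (0,1) of the basis of `W`, so any block
            -- containing `W` contains both.
            let same = unique (V⊆hX (W⊆V (⊆W (true ∷ false ∷ [] , sym linComb₁₀)))) (V⊆hX (W⊆V (⊆W (false ∷ true ∷ [] , sym linComb₀₁))))
            in hX⊆V ∘ proj₁ same , proj₂ same ∘ V⊆hX } }
      }
      where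
      module Through {x y : F₂^ n} (independent : LinearlyIndependent (x ∷ y ∷ [])) where

        x≢𝟎 : x ≢ 𝟎
        x≢𝟎 = independent⇒≢𝟎ˡ independent

        y≢𝟎 : y ≢ 𝟎
        y≢𝟎 = independent⇒≢𝟎ʳ independent

        y≢x : y ≢ x
        y≢x = independent⇒≢ independent

        triple : ∃[ p ] Triple p × ratio p ≡ logRatio x y
        triple = ratio-onto x≢𝟎 y≢𝟎 y≢x

        a = proj₁ (proj₁ triple)
        u = proj₁ (proj₂ (proj₁ triple))
        v = proj₂ (proj₂ (proj₁ triple))

        a,u,v∈ : Triple (a , u , v)
        a,u,v∈ = proj₁ (proj₂ triple)

        u∈X : u ∈ elements (X a)
        u∈X = proj₁ (proj₁ (proj₂ a,u,v∈))

        u≢𝟎 : u ≢ 𝟎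
        u≢𝟎 = proj₂ (proj₁ (proj₂ a,u,v∈))

        v∈X : v ∈ elements (X a)
        v∈X = proj₁ (proj₁ (proj₂ (proj₂ a,u,v∈)))

        v≢𝟎 : v ≢ 𝟎
        v≢𝟎 = proj₂ (proj₁ (proj₂ (proj₂ a,u,v∈)))

        u⊛y≡x⊛v : u ⊛ y ≡ x ⊛ v
        u⊛y≡x⊛v = logRatio≡⇒ u≢𝟎 v≢𝟎 x≢𝟎 y≢𝟎 (proj₂ (proj₂ triple))

        u⁻¹ = proj₁ (invertible u u≢𝟎)
        g = x ⊛ u⁻¹

        g⊛u≡x : g ⊛ u ≡ x
        g⊛u≡x = trans (*-assoc x u⁻¹ u)
          (trans (cong (x ⊛_) (proj₁ (proj₂ (invertible u u≢𝟎)))) (*-identityʳ x))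

        g≢𝟎 : g ≢ 𝟎
        g≢𝟎 g≡𝟎 = x≢𝟎 (trans (sym g⊛u≡x) (trans (cong (_⊛ u) g≡𝟎) (zeroˡ u)))

        -- The quotients `u / v` and `x / y` agree, so the factor that takes `u` to `x` also takes
        -- `v` to `y`.
        g⊛v≡y : g ⊛ v ≡ y
        g⊛v≡y = cancelʳ u≢𝟎 (begin
          (g ⊛ v) ⊛ u  ≡⟨ xy∙z≈xz∙y g v u ⟩
          (g ⊛ u) ⊛ v  ≡⟨ cong (_⊛ v) g⊛u≡x ⟩
          x ⊛ v        ≡⟨ u⊛y≡x⊛v ⟨
          u ⊛ y        ≡⟨ *-comm u y ⟩
          y ⊛ u        ∎)

        -- Dividing `x` and `y` by `h` gives a triple with the same quotient `x / y`, hence the same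
        -- triple. Then `g ⊛ u` and `h ⊛ u` both equal `x`, and cancelling `u` gives equal factors.
        unique : ∀ {b h} → x ∈ elements (multiple h b) → y ∈ elements (multiple h b) →
          multiple g a ≈ˢ multiple h b
        unique {b} {h} (u′ , u′∈X , x≡h⊛u′) (v′ , v′∈X , y≡h⊛v′) =
          same (ratio-injective a,u,v∈ (refl , (u′∈X , u′≢𝟎) , (v′∈X , v′≢𝟎) , v′≢u′)
            (trans (proj₂ (proj₂ triple)) (⇒logRatio≡ x≢𝟎 y≢𝟎 u′≢𝟎 v′≢𝟎 x⊛v′≡u′⊛y)))
          where
          same : (a , u , v) ≡ (b , u′ , v′) → multiple g a ≈ˢ multiple h b
          same refl = subst (λ c → multiple g a ≈ˢ multiple c a)
            (cancelʳ u≢𝟎 (trans g⊛u≡x x≡h⊛u′)) (id , id)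

          u′≢𝟎 : u′ ≢ 𝟎
          u′≢𝟎 eq = x≢𝟎 (trans x≡h⊛u′ (trans (cong (h ⊛_) eq) (zeroʳ h)))

          v′≢𝟎 : v′ ≢ 𝟎
          v′≢𝟎 eq = y≢𝟎 (trans y≡h⊛v′ (trans (cong (h ⊛_) eq) (zeroʳ h)))

          v′≢u′ : v′ ≢ u′
          v′≢u′ eq = y≢x (trans y≡h⊛v′ (trans (cong (h ⊛_) eq) (sym x≡h⊛u′)))

          x⊛v′≡u′⊛y : x ⊛ v′ ≡ u′ ⊛ y
          x⊛v′≡u′⊛y = begin
            x ⊛ v′          ≡⟨ cong (_⊛ v′) x≡h⊛u′ ⟩
            (h ⊛ u′) ⊛ v′   ≡⟨ xy∙z≈xz∙y h u′ v′ ⟩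
            (h ⊛ v′) ⊛ u′   ≡⟨ cong (_⊛ u′) y≡h⊛v′ ⟨
            y ⊛ u′          ≡⟨ *-comm y u′ ⟩
            u′ ⊛ y          ∎

-- Transfer along the identification 𝔽₂ⁿ ≅ F

module Pullback {c ℓ : Level} {n : ℕ} (F : CommutativeRing c ℓ) (isField : IsField F)
  (φ : F₂^ n → CommutativeRing.Carrier F) (isIdentification : IsIdentification F n φ)
  where

  open CommutativeRing F
    using (Carrier; _≈_; 0#; 1#; rawRing)
    renaming (_*_ to _*ᶠ_; sym to ≈-sym; trans to ≈-trans; reflexive to ≈-reflexive;
              *-cong to *ᶠ-cong; *-congʳ to *ᶠ-congʳ; *-congˡ to *ᶠ-congˡ)
  open LeftModuleMorphisms.IsLeftModuleIsomorphism isIdentification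
    using (+ᴹ-isGroupMonomorphism; surjective; 0ᴹ-homo)
    renaming (injective to φ-injective)
  open IsField isField using (1≉0; invertible)

  ψ : Carrier → F₂^ n
  ψ x = proj₁ (surjective x)

  φ-ψ : ∀ x → φ (ψ x) ≈ x
  φ-ψ x = proj₂ (surjective x) refl

  -- `φ` already respects `⊕`, so only multiplication and unit are carried back; the subspaces
  -- remain unchanged.
  pulledBackRawRing : RawRing 0ℓ 0ℓ
  pulledBackRawRing = record
    { Carrier = F₂^ n ; _≈_ = _≡_ ; _+_ = _⊕_ ; _*_ = λ u v → ψ (φ u *ᶠ φ v)
    ; -_ = id ; 0# = 𝟎 ; 1# = ψ 1# }

  φ-isRingMonomorphism : IsRingMonomorphism pulledBackRawRing rawRing φ
  φ-isRingMonomorphism = record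
    { isRingHomomorphism = record
      { isSemiringHomomorphism = record
        { isNearSemiringHomomorphism = record
          { +-isMonoidHomomorphism = isMonoidHomomorphism
          ; *-homo = λ u v → φ-ψ (φ u *ᶠ φ v)
          }
        ; 1#-homo = φ-ψ 1#
        }
      ; -‿homo = ⁻¹-homo
      }
    ; injective = φ-injective
    }
    where open GroupMorphisms.IsGroupMonomorphism +ᴹ-isGroupMonomorphism using (isMonoidHomomorphism; ⁻¹-homo)

  -- Injectivity of `φ` lets the ring equations be checked in `F`.
  isCommutativeRing : IsCommutativeRing _≡_ _⊕_ (λ u v → ψ (φ u *ᶠ φ v)) id 𝟎 (ψ 1#)
  isCommutativeRing =
    RingMonomorphism.isCommutativeRing φ-isRingMonomorphism (CommutativeRing.isCommutativeRing F)

  ring : CommutativeRing 0ℓ 0ℓ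
  ring = ringOn isCommutativeRing

  open Exp (CommutativeRing.semiring F) using () renaming (_^_ to _^ᶠ_)
  open Exp (CommutativeRing.semiring ring) using () renaming (_^_ to _^ᵛ_)

  φ-≉0 : ∀ {v} → v ≢ 𝟎 → ¬ (φ v ≈ 0#)
  φ-≉0 v≢𝟎 eq = v≢𝟎 (φ-injective (≈-trans eq (≈-sym 0ᴹ-homo)))

  ring-isField : IsField ring
  ring-isField = record
    { 1≉0        = λ eq → 1≉0 (≈-trans (≈-sym (φ-ψ 1#)) (≈-trans (≈-reflexive (cong φ eq)) 0ᴹ-homo))
    ; invertible = λ v v≢𝟎 → let y , y*φv≈1 , φv*y≈1 = invertible (φ v) (φ-≉0 v≢𝟎) in
        ψ y ,
        φ-injective (≈-trans (φ-ψ _) (≈-trans (*ᶠ-congʳ (φ-ψ y)) (≈-trans y*φv≈1 (≈-sym (φ-ψ 1#))))) ,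
        φ-injective (≈-trans (φ-ψ _) (≈-trans (*ᶠ-congˡ (φ-ψ y)) (≈-trans φv*y≈1 (≈-sym (φ-ψ 1#)))))
    }

  module _ (α : Carrier) where

    φ-ψ^ : ∀ i → φ (ψ α ^ᵛ i) ≈ α ^ᶠ i
    φ-ψ^ zero    = φ-ψ 1#
    φ-ψ^ (suc i) = ≈-trans (φ-ψ _) (*ᶠ-cong (φ-ψ α) (φ-ψ^ i))

    ψ-isPrimitive : IsPrimitive F α → IsPrimitive ring (ψ α)
    ψ-isPrimitive isPrimitive = record
      { nonzero   = λ eq → nonzero (≈-trans (≈-sym (φ-ψ α)) (≈-trans (≈-reflexive (cong φ eq)) 0ᴹ-homo))
      ; generates = λ v v≢𝟎 → let i , φv≈α^i = generates (φ v) (φ-≉0 v≢𝟎) in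
          i , φ-injective (≈-trans φv≈α^i (≈-sym (φ-ψ^ i)))
      }
      where open IsPrimitive isPrimitive

    -- The same `v` is a witness on both sides, because `φ` is injective and sends powers of `ψ α`
    -- to powers of `α`.
    Exponents⇒ : ∀ X i → i ∈ Exponents F φ α X → i ∈ Exponents ring id (ψ α) X
    Exponents⇒ X i (v , v∈X , eq) = v , v∈X , φ-injective (≈-trans eq (≈-sym (φ-ψ^ (toℕ i))))

    Exponents⇐ : ∀ X i → i ∈ Exponents ring id (ψ α) X → i ∈ Exponents F φ α X
    Exponents⇐ X i (v , v∈X , eq) = v , v∈X , ≈-trans (≈-reflexive (cong φ eq)) (φ-ψ^ (toℕ i))

    Δ⇒ : ∀ {X} → Δ F φ α X ⊆ Δ ring id (ψ α) X
    Δ⇒ {X} (i , j , i∈ , j∈ , rest) = i , j , Exponents⇒ X i i∈ , Exponents⇒ X j j∈ , rest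

    Δ⇐ : ∀ {X} → Δ ring id (ψ α) X ⊆ Δ F φ α X
    Δ⇐ {X} (i , j , i∈ , j∈ , rest) = i , j , Exponents⇐ X i i∈ , Exponents⇐ X j j∈ , rest

    -- Both difference sets have the same members, so the same finite subset `S` witnesses the
    -- cardinality.
    pairwiseDisjointComplete : ∀ {k N} {X : Fin N → Subspace n} →
      PairwiseDisjointComplete F φ α k X → PairwiseDisjointComplete ring id (ψ α) k X
    pairwiseDisjointComplete {X = X} (complete , disjoint) =
      (λ a → let open IsComplete (complete a); S , S⇔Δ , ∣S∣≡ = cardinality in record
        { dimension   = dimension
        ; cardinality = S ,
            (λ d → mk⇔ (Δ⇒ {X a} ∘ Equivalence.to (S⇔Δ d)) (Equivalence.from (S⇔Δ d) ∘ Δ⇐ {X a})) ,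
            ∣S∣≡
        }) ,
      (λ a b a≢b d (d∈Δa , d∈Δb) → disjoint a b a≢b d (Δ⇐ {X a} d∈Δa , Δ⇐ {X b} d∈Δb))

theorem1 : ∀ {c ℓ : Level} (n : ℕ) → Prime n →
    (F : CommutativeRing c ℓ) → IsField F →
    (φ : F₂^ n → CommutativeRing.Carrier F) → IsIdentification F n φ →
    (α : CommutativeRing.Carrier F) → IsPrimitive F α →
    (k : ℕ) → 2 ≤ k →
    (N : ℕ) → N * ((2 ^ k ∸ 1) * (2 ^ k ∸ 2)) ≡ 2 ^ n ∸ 2 →
    (∃ λ (X : Fin N → Subspace n) → PairwiseDisjointComplete F φ α k X) →
    ∃ λ (𝕊 : Pred (Subspace n) 0ℓ) → IsSteinerStructure 2 k n 𝕊
theorem1 n _ F isField φ isIdentification α isPrimitive k _ N count (X , disjointComplete) =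
  blocks count X disjointComplete′ , blocks-isSteinerStructure count X disjointComplete′
  where
  open Pullback F isField φ isIdentification
  open FieldOnVectors isCommutativeRing ring-isField (ψ α) (ψ-isPrimitive α isPrimitive)
  disjointComplete′ = pairwiseDisjointComplete α disjointComplete
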